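{- For positive integers $z$: \begin{align*} z\in S_{1,2,3}&\iff z\in\{1,5,13\}\ \text{ or }\ z\bmod 23\in\{2,3,4,14,15\};\\ z\in S_{1,3,4}&\iff z\in\{1,7,19\}\ \text{ or }\ z\bmod 33\in\{3,4,5,6,20,21,22\};\\ z\in S_{1,4,5}&\iff z\in\{1,9,25\}\ \text{ or }\ z\bmod 43\in\{4,5,6,7,8,26,27,28,29\}. \end{align*}
   Context: For positive integers $x<y<z$, the greedy 3-subsumfree sequence $S_{x,y,z}$ is the sequence $(a_n)_{n\ge 1}$ with $a_1=x$, $a_2=y$, $a_3=z$ and, for $n>3$, $a_n$ is the smallest integer exceeding $a_{n-1}$ that is not the sum of three different previous entries, i.e. $a_n\ne a_i+a_j+a_k$ for all $1\le i<j<k<n$. We write $w\in S_{x,y,z}$ if $w$ is an entry of this sequence. Here $z\bmod m$ denotes the remainder in $\{0,1,\ldots,m-1\}$ of $z$ on division by $m$. -}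

module Defs where

open import Data.Nat using (ℕ; zero; suc; _+_; _≤_; _<_; _≤?_; _<?_; _≟_; z≤n; s≤s; s≤s⁻¹)
open import Data.Nat.Properties
open import Data.Product using (∃; ∃-syntax; _×_; _,_; proj₁; proj₂)
open import Data.Sum using (inj₁; inj₂)
open import Relation.Binary.PropositionalEquality
  using (_≡_; refl; sym; trans; cong; cong₂; subst)
open import Relation.Nullary using (¬_; yes; no; ¬?; _×-dec_; contradiction)
open import Relation.Unary using (Pred; Decidable)
open import Level using (0ℓ)

-- Sequences are indexed from 0: `a n` is the entry usually written a_{n+1}.

SumOfThree : (ℕ → ℕ) → ℕ → ℕ → Set
SumOfThree a n m =
  ∃[ k ] k < n × ∃[ j ] j < k × ∃[ i ] i < j × m ≡ a i + a j + a k

-- The integers allowed as the entry following a 0, …, a n.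
Candidate : (ℕ → ℕ) → ℕ → ℕ → Set
Candidate a n m = a n < m × ¬ SumOfThree a (suc n) m

IsLeast : Pred ℕ 0ℓ → ℕ → Set
IsLeast P m = P m × (∀ {k} → P k → m ≤ k)

record IsGreedy (x y z : ℕ) (a : ℕ → ℕ) : Set where
  field
    first  : a 0 ≡ x
    second : a 1 ≡ y
    third  : a 2 ≡ z
    greedy : ∀ n → 2 ≤ n → IsLeast (Candidate a n) (a (suc n))

sumOfThree? : ∀ a n → Decidable (SumOfThree a n)
sumOfThree? a n m =
  anyUpTo? (λ k → anyUpTo? (λ j → anyUpTo? (λ i → m ≟ a i + a j + a k) j) k) n

candidate? : ∀ a n → Decidable (Candidate a n)
candidate? a n m = (a n <? m) ×-dec ¬? (sumOfThree? a (suc n) m)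

least : {P : Pred ℕ 0ℓ} → Decidable P → ∀ m → P m → ∃ (IsLeast P)
least P? zero    p = zero , p , λ _ → z≤n
least {P} P? (suc m) p with P? zero
... | yes p₀ = zero , p₀ , λ _ → z≤n
... | no ¬p₀ with least (λ k → P? (suc k)) m p
...   | l , pl , min = suc l , pl , bound
  where
  bound : ∀ {k} → P k → suc l ≤ k
  bound {zero}  q = contradiction q ¬p₀
  bound {suc k} q = s≤s (min q)

total : (ℕ → ℕ) → ℕ → ℕ
total a zero    = a 0
total a (suc n) = total a n + a (suc n)

entry≤total : ∀ a n {i} → i ≤ n → a i ≤ total a n
entry≤total a zero    z≤n = ≤-refl
entry≤total a (suc n) {i} i≤1+n with m≤n⇒m<n∨m≡n i≤1+n
... | inj₁ i<1+n = ≤-trans (entry≤total a n (s≤s⁻¹ i<1+n)) (m≤m+n _ _)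
... | inj₂ refl  = m≤n+m _ _

candidateExists : ∀ a n → ∃ (Candidate a n)
candidateExists a n = suc (t + t + t) , above , notSum
  where
  t = total a n
  above : a n < suc (t + t + t)
  above = s≤s (≤-trans (entry≤total a n ≤-refl) (m≤n+m t (t + t)))
  notSum : ¬ SumOfThree a (suc n) (suc (t + t + t))
  notSum (k , k<1+n , j , j<k , i , i<j , eq) =
    <-irrefl (sym eq) (s≤s (+-mono-≤ (+-mono-≤ (le i≤n) (le j≤n)) (le k≤n)))
    where
    le : ∀ {i} → i ≤ n → a i ≤ t
    le = entry≤total a n
    k≤n = s≤s⁻¹ k<1+n
    j≤n = ≤-trans (<⇒≤ j<k) k≤n
    i≤n = ≤-trans (<⇒≤ i<j) j≤n

leastCandidate : ∀ a n → ∃ (IsLeast (Candidate a n))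
leastCandidate a n =
  least (candidate? a n) (proj₁ (candidateExists a n)) (proj₂ (candidateExists a n))

-- `stage x y z k` is correct at the indices 0, …, 2 + k; its later values
-- are irrelevant.
stage : (x y z : ℕ) → ℕ → ℕ → ℕ
stage x y z zero    zero          = x
stage x y z zero    (suc zero)    = y
stage x y z zero    (suc (suc _)) = z
stage x y z (suc k) i with i ≤? 2 + k
... | yes _ = stage x y z k i
... | no  _ = proj₁ (leastCandidate (stage x y z k) (2 + k))

S[_,_,_] : (x y z : ℕ) → ℕ → ℕ
S[ x , y , z ] n = stage x y z n n

infix 4 _∈S[_,_,_]

_∈S[_,_,_] : ℕ → (x y z : ℕ) → Set
w ∈S[ x , y , z ] = ∃[ n ] S[ x , y , z ] n ≡ w

module _ (x y z : ℕ) where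

  stage-suc : ∀ k {i} → i ≤ 2 + k → stage x y z (suc k) i ≡ stage x y z k i
  stage-suc k {i} i≤ with i ≤? 2 + k
  ... | yes _ = refl
  ... | no i≰ = contradiction i≤ i≰

  stage-+ : ∀ d k {i} → i ≤ 2 + k → stage x y z (d + k) i ≡ stage x y z k i
  stage-+ zero    k i≤ = refl
  stage-+ (suc d) k i≤ =
    trans (stage-suc (d + k) (≤-trans i≤ (s≤s (s≤s (m≤n+m k d))))) (stage-+ d k i≤)

  stage≡S : ∀ k i → i ≤ 2 + k → stage x y z k i ≡ S[ x , y , z ] i
  stage≡S k i i≤ =
    trans (sym (stage-+ i k i≤))
      (trans (cong (λ l → stage x y z l i) (+-comm i k)) (stage-+ k i (m≤n+m i 2)))

  stage-new : ∀ k → stage x y z (suc k) (3 + k)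
                    ≡ proj₁ (leastCandidate (stage x y z k) (2 + k))
  stage-new k with 3 + k ≤? 2 + k
  ... | yes 3+k≤2+k = contradiction 3+k≤2+k (<-irrefl refl)
  ... | no _ = refl

Candidate-cong : ∀ {a b n m} → (∀ i → i ≤ n → a i ≡ b i) → Candidate a n m → Candidate b n m
Candidate-cong {a} {b} {n} {m} a≗b (an<m , ¬sum) = subst (_< m) (a≗b n ≤-refl) an<m , ¬sum′
  where
  ¬sum′ : ¬ SumOfThree b (suc n) m
  ¬sum′ (k , k<1+n , j , j<k , i , i<j , eq) =
    ¬sum (k , k<1+n , j , j<k , i , i<j ,
      trans eq (sym (cong₂ _+_ (cong₂ _+_ (a≗b i i≤n) (a≗b j j≤n)) (a≗b k k≤n))))
    where
    k≤n = s≤s⁻¹ k<1+n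
    j≤n = ≤-trans (<⇒≤ j<k) k≤n
    i≤n = ≤-trans (<⇒≤ i<j) j≤n

S-isGreedy : ∀ x y z → IsGreedy x y z S[ x , y , z ]
S-isGreedy x y z = record { first = refl ; second = second ; third = third ; greedy = greedy }
  where
  second : S[ x , y , z ] 1 ≡ y
  second = sym (stage≡S x y z 0 1 (s≤s z≤n))
  third : S[ x , y , z ] 2 ≡ z
  third = sym (stage≡S x y z 0 2 ≤-refl)
  greedy : ∀ n → 2 ≤ n → IsLeast (Candidate S[ x , y , z ] n) (S[ x , y , z ] (suc n))
  greedy (suc (suc k)) _ = subst (IsLeast (Candidate S[ x , y , z ] (2 + k))) new isLeast
    where
    agree : ∀ i → i ≤ 2 + k → stage x y z k i ≡ S[ x , y , z ] i
    agree = stage≡S x y z k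
    spec = leastCandidate (stage x y z k) (2 + k)
    new : proj₁ spec ≡ S[ x , y , z ] (3 + k)
    new = trans (sym (stage-new x y z k)) (stage≡S x y z (suc k) (3 + k) ≤-refl)
    isLeast : IsLeast (Candidate S[ x , y , z ] (2 + k)) (proj₁ spec)
    isLeast = Candidate-cong agree (proj₁ (proj₂ spec)) ,
      λ c → proj₂ (proj₂ spec) (Candidate-cong (λ i i≤ → sym (agree i i≤)) c)
  greedy (suc zero) (s≤s ())

{-# OPTIONS --safe #-}
-- A set T is the set of entries of the greedy sequence as soon as it starts
-- with the three given entries, contains no sum of three different elements of
-- itself, and every larger number outside T is such a sum.  When T consists of
-- finitely many exceptions below m together with some residue classes mod m,
-- both conditions are finite checks: sums only matter mod m, and a
-- representation p + q + k of a large w, with p and q bounded, is carried to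
-- w + m by replacing k by k + m.
module Submission where

open import Defs
open import Data.Nat
  using (ℕ; zero; suc; _+_; _*_; _∸_; _≤_; _<_; _≤?_; _<?_; _≟_; NonZero; z≤n; s≤s; s≤s⁻¹; _%_; _/_)
open import Data.Nat.Properties
open import Data.Nat.DivMod
  using (m≡m%n+[m/n]*n; m%n<n; m<n⇒m%n≡m; [m+kn]%n≡m%n; %-distribˡ-+; m%n%n≡m%n)
open import Data.List using (List; []; _∷_; _++_)
open import Data.List.Membership.Propositional using (_∈_; find)
open import Data.List.Membership.Propositional.Properties using (∈-++⁺ˡ; ∈-++⁺ʳ)
open import Data.List.Membership.DecPropositional _≟_ using (_∈?_)
open import Data.List.Relation.Unary.All as All using (All)
open import Data.List.Relation.Unary.Any as Any using (Any; here; there)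
open import Data.Product using (∃-syntax; _×_; _,_; proj₁; proj₂)
open import Data.Sum using (_⊎_; inj₁; inj₂; [_,_]′)
open import Function using (_∘_)
open import Function.Bundles using (_⇔_; mk⇔; Equivalence)
open import Level using (0ℓ)
open import Relation.Binary.PropositionalEquality
  using (_≡_; refl; sym; trans; cong; cong₂; subst; subst₂; module ≡-Reasoning)
open import Relation.Nullary
  using (¬_; Dec; yes; no; ¬?; _×-dec_; _⊎-dec_; _→-dec_; contradiction)
open import Relation.Nullary.Decidable using (from-yes)
open import Relation.Unary using (Pred; Decidable)

-- Greedy sequences with a prescribed set of entries.

DistinctSum : Pred ℕ 0ℓ → ℕ → Set
DistinctSum T w =
  ∃[ i ] ∃[ j ] ∃[ k ] i < j × j < k × T i × T j × T k × w ≡ i + j + k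

module _ {x y z : ℕ} {a : ℕ → ℕ} (g : IsGreedy x y z a) (x<y : x < y) (y<z : y < z) where
  open IsGreedy g

  entry-step : ∀ n → a n < a (suc n)
  entry-step zero = subst₂ _<_ (sym first) (sym second) x<y
  entry-step (suc zero) = subst₂ _<_ (sym second) (sym third) y<z
  entry-step (suc (suc n)) = proj₁ (proj₁ (greedy (2 + n) (s≤s (s≤s z≤n))))

  entry-mono-< : ∀ {i j} → i < j → a i < a j
  entry-mono-< {i} {suc j} i<1+j with m≤n⇒m<n∨m≡n (s≤s⁻¹ i<1+j)
  ... | inj₁ i<j  = <-trans (entry-mono-< i<j) (entry-step j)
  ... | inj₂ refl = entry-step i

  entry-cancel-< : ∀ {i j} → a i < a j → i < j
  entry-cancel-< {i} {j} ai<aj with i <? j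
  ... | yes i<j = i<j
  ... | no i≮j with m≤n⇒m<n∨m≡n (≮⇒≥ i≮j)
  ...   | inj₁ j<i  = contradiction ai<aj (<-asym (entry-mono-< j<i))
  ...   | inj₂ refl = contradiction ai<aj (<-irrefl refl)

  n≤entry : ∀ n → n ≤ a n
  n≤entry zero    = z≤n
  n≤entry (suc n) = ≤-<-trans (n≤entry n) (entry-step n)

  module _ {T : Pred ℕ 0ℓ} (T? : Decidable T)
    (initial : ∀ {w} → w ≤ z → T w ⇔ w ∈ x ∷ y ∷ z ∷ [])
    (sumFree : ∀ {w} → DistinctSum T w → ¬ T w)
    (cover : ∀ {w} → z < w → ¬ T w → DistinctSum T w)
    where
    open Equivalence

    -- The induction invariant. The first half lets `sumFree` apply to sums of entries; the second
    -- turns a sum of elements of `T` into a sum of entries with indices.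
    EnumeratesUpTo : ℕ → Set
    EnumeratesUpTo n =
      (∀ {i} → i ≤ n → T (a i)) × (∀ {w} → w ≤ a n → T w → ∃[ i ] i ≤ n × a i ≡ w)

    enumerates-start : EnumeratesUpTo 2
    enumerates-start = sound , complete
      where
      sound : ∀ {i} → i ≤ 2 → T (a i)
      sound {0} _ = subst T (sym first) (from (initial (<⇒≤ (<-trans x<y y<z))) (here refl))
      sound {1} _ = subst T (sym second) (from (initial (<⇒≤ y<z)) (there (here refl)))
      sound {2} _ = subst T (sym third) (from (initial ≤-refl) (there (there (here refl))))
      sound {suc (suc (suc _))} (s≤s (s≤s ()))
      complete : ∀ {w} → w ≤ a 2 → T w → ∃[ i ] i ≤ 2 × a i ≡ w
      complete {w} w≤ Tw with to (initial (subst (w ≤_) third w≤)) Tw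
      ... | here refl                 = 0 , z≤n , first
      ... | there (here refl)         = 1 , s≤s z≤n , second
      ... | there (there (here refl)) = 2 , ≤-refl , third

    -- By `sumFree` each element of `T` above `a n` is a candidate, so the minimal candidate `next`
    -- skips none. Were `next` outside `T`, `cover` would write it as a sum of smaller elements of
    -- `T`; these are at most `a n`, hence earlier entries, and `next` would not be a candidate.
    enumerates-step : ∀ n → 2 ≤ n → EnumeratesUpTo n → EnumeratesUpTo (suc n)
    enumerates-step n 2≤n (sound , complete) = sound′ , complete′
      where
      next = a (suc n)
      next∉sums = proj₂ (proj₁ (greedy n 2≤n))
      next-min = proj₂ (greedy n 2≤n)

      element-candidate : ∀ {w} → a n < w → T w → Candidate a n w
      element-candidate an<w Tw = an<w , λ where
        (k , k<1+n , j , j<k , i , i<j , eq) →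
          let k≤n = s≤s⁻¹ k<1+n
              j≤n = ≤-trans (<⇒≤ j<k) k≤n
              i≤n = ≤-trans (<⇒≤ i<j) j≤n
          in sumFree
               (a i , a j , a k , entry-mono-< i<j , entry-mono-< j<k ,
                sound i≤n , sound j≤n , sound k≤n , eq)
               Tw

      below-next : ∀ {w} → T w → w < next → w ≤ a n
      below-next {w} Tw w<next with w ≤? a n
      ... | yes w≤an = w≤an
      ... | no w≰an = contradiction (next-min (element-candidate (≰⇒> w≰an) Tw)) (<⇒≱ w<next)

      representable : DistinctSum T next → SumOfThree a (suc n) next
      representable (u , v , w , u<v , v<w , Tu , Tv , Tw , eq)
        -- `u < v` makes `v` positive, so even the largest summand is strictly below `next`.
        with w≤an ← below-next Tw
               (subst (w <_) (sym eq) (m<n+m w (≤-trans (≤-trans (s≤s z≤n) u<v) (m≤n+m v u))))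
        with complete w≤an Tw
           | complete (≤-trans (<⇒≤ v<w) w≤an) Tv
           | complete (≤-trans (<⇒≤ (<-trans u<v v<w)) w≤an) Tu
      ... | k , k≤n , refl | j , _ , refl | i , _ , refl =
        k , s≤s k≤n , j , entry-cancel-< v<w , i , entry-cancel-< u<v , eq

      T-next : T next
      T-next with T? next
      ... | yes t = t
      ... | no ¬t = contradiction (representable (cover z<next ¬t)) next∉sums
        where
        z<next : z < next
        z<next = subst (_< next) third (entry-mono-< (s≤s 2≤n))

      sound′ : ∀ {i} → i ≤ suc n → T (a i)
      sound′ i≤1+n with m≤n⇒m<n∨m≡n i≤1+n
      ... | inj₁ i<1+n = sound (s≤s⁻¹ i<1+n)
      ... | inj₂ refl  = T-next

      complete′ : ∀ {w} → w ≤ next → T w → ∃[ i ] i ≤ suc n × a i ≡ w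
      complete′ w≤next Tw with m≤n⇒m<n∨m≡n w≤next
      ... | inj₂ refl = suc n , ≤-refl , refl
      ... | inj₁ w<next with complete (below-next Tw w<next) Tw
      ...   | i , i≤n , eq = i , m≤n⇒m≤1+n i≤n , eq

    enumerates : ∀ n → EnumeratesUpTo (2 + n)
    enumerates zero    = enumerates-start
    enumerates (suc n) = enumerates-step (2 + n) (s≤s (s≤s z≤n)) (enumerates n)

    entry⇔ : ∀ w → (∃[ n ] a n ≡ w) ⇔ T w
    entry⇔ w = mk⇔
      (λ (n , eq) → subst T eq (proj₁ (enumerates n) (m≤n+m n 2)))
      -- Entries are at least their indices, so index `2 + w` is far enough to have met `w`.
      λ Tw → let i , _ , eq = proj₂ (enumerates w) (≤-trans (m≤n+m w 2) (n≤entry (2 + w))) Tw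
             in i , eq

-- Sets that are periodic apart from finitely many exceptions.

module Periodic (E R : List ℕ) (m : ℕ) .{{_ : NonZero m}} where

  Pattern : Pred ℕ 0ℓ
  Pattern w = w ∈ E ⊎ w % m ∈ R

  pattern? : Decidable Pattern
  pattern? w = (w ∈? E) ⊎-dec (w % m ∈? R)

  -- Ensures that an element of the pattern whose residue lies in `E` is that exception itself.
  Separated : Set
  Separated = All (λ e → e < m × ¬ e ∈ R) E

  separated? : Dec Separated
  separated? = All.all? (λ e → (e <? m) ×-dec ¬? (e ∈? R)) E

  -- Two elements of the pattern with the same residue are equal when that
  -- residue is an exception.
  Clash : ℕ → ℕ → Set
  Clash p q = p ≡ q × p ∈ E

  -- Meant for the residues of three different elements. Different elements may share a residue in
  -- `R`, so when the sum falls into `R` only a repeated exception is absurd. A sum in `E` is below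
  -- `m`, so its summands are their own residues and any repetition is absurd.
  Harmless : ℕ → ℕ → ℕ → Set
  Harmless p q r =
    ((p + q + r) % m ∈ R → Clash p q ⊎ Clash q r ⊎ Clash p r) ×
    (p + q + r ∈ E → p ≡ q ⊎ q ≡ r ⊎ p ≡ r)

  SumsHarmless : Set
  SumsHarmless = All (λ p → All (λ q → All (Harmless p q) (E ++ R)) (E ++ R)) (E ++ R)

  sumsHarmless? : Dec SumsHarmless
  sumsHarmless? =
    All.all? (λ p → All.all? (λ q → All.all? (harmless? p q) (E ++ R)) (E ++ R)) (E ++ R)
    where
    clash? : ∀ p q → Dec (Clash p q)
    clash? p q = (p ≟ q) ×-dec (p ∈? E)
    harmless? : ∀ p q r → Dec (Harmless p q r)
    harmless? p q r =
      (((p + q + r) % m ∈? R) →-dec (clash? p q ⊎-dec (clash? q r ⊎-dec clash? p r))) ×-dec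
      ((p + q + r ∈? E) →-dec ((p ≟ q) ⊎-dec ((q ≟ r) ⊎-dec (p ≟ r))))

  -- p + q + q < w makes the third summand w ∸ (p + q) the largest; p + q ≤ 2m
  -- makes it at least m, hence shiftable by m, once w ≥ 3m.
  Completes : ℕ → ℕ → ℕ → Set
  Completes w p q =
    p < q × p + q + q < w × p + q ≤ 2 * m × Pattern p × Pattern q × Pattern (w ∸ (p + q))

  -- The bound `4 * m` includes the full period from `3 * m` on, to which all larger `w` are
  -- reduced. The two smaller summands are sought only among the members of `E` and `R`, read as
  -- numbers.
  CoveredFrom : ℕ → Set
  CoveredFrom z =
    ∀ {w} → w < 4 * m → z < w → ¬ Pattern w → Any (λ p → Any (Completes w p) (E ++ R)) (E ++ R)

  coveredFrom? : ∀ z → Dec (CoveredFrom z)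
  coveredFrom? z = allUpTo? (λ w → (z <? w) →-dec (¬? (pattern? w) →-dec
    Any.any? (λ p → Any.any? (λ q →
      (p <? q) ×-dec ((p + q + q <? w) ×-dec ((p + q ≤? 2 * m) ×-dec
      (pattern? p ×-dec (pattern? q ×-dec pattern? (w ∸ (p + q)))))))
      (E ++ R)) (E ++ R))) (4 * m)

  sum-% : ∀ i j k → (i + j + k) % m ≡ (i % m + j % m + k % m) % m
  sum-% i j k = begin
    (i + j + k) % m                        ≡⟨ %-distribˡ-+ (i + j) k m ⟩
    ((i + j) % m + k % m) % m              ≡⟨ cong (λ s → (s + k % m) % m) (%-distribˡ-+ i j m) ⟩
    ((i % m + j % m) % m + k % m) % m      ≡⟨ cong (λ s → ((i % m + j % m) % m + s) % m) (m%n%n≡m%n k m) ⟨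
    ((i % m + j % m) % m + k % m % m) % m  ≡⟨ %-distribˡ-+ (i % m + j % m) (k % m) m ⟨
    (i % m + j % m + k % m) % m            ∎
    where open ≡-Reasoning

  -- From the finite checks to all integers.

  module _ (separated : Separated) where

    exception-residue : ∀ {w} → w ∈ E → w % m ≡ w
    exception-residue w∈E = m<n⇒m%n≡m (proj₁ (All.lookup separated w∈E))

    residue : ∀ {w} → Pattern w → w % m ∈ E ++ R
    residue (inj₁ w∈E) = subst (_∈ E ++ R) (sym (exception-residue w∈E)) (∈-++⁺ˡ w∈E)
    residue (inj₂ w%m∈R) = ∈-++⁺ʳ E w%m∈R

    exception : ∀ {w} → Pattern w → w % m ∈ E → w % m ≡ w
    exception (inj₁ w∈E) _ = exception-residue w∈E
    exception (inj₂ w%m∈R) w%m∈E = contradiction w%m∈R (proj₂ (All.lookup separated w%m∈E))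

    ¬clash : ∀ {u v} → Pattern u → Pattern v → u < v → ¬ Clash (u % m) (v % m)
    ¬clash Pu Pv u<v (eq , ∈E) =
      <⇒≢ u<v (trans (sym (exception Pu ∈E)) (trans eq (exception Pv (subst (_∈ E) eq ∈E))))

    pattern-sumFree : SumsHarmless → ∀ {w} → DistinctSum Pattern w → ¬ Pattern w
    pattern-sumFree harmless (i , j , k , i<j , j<k , Pi , Pj , Pk , refl) = λ where
        (inj₂ sum∈R) →
          [ ¬clash Pi Pj i<j , [ ¬clash Pj Pk j<k , ¬clash Pi Pk (<-trans i<j j<k) ]′ ]′
            (proj₁ check (subst (_∈ R) (sum-% i j k) sum∈R))
        -- All exceptions lie below `m`, so here reduction mod `m` changes none of the summands.
        (inj₁ sum∈E) →
          let sum<m = proj₁ (All.lookup separated sum∈E)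
              i% = m<n⇒m%n≡m (≤-<-trans (≤-trans (m≤m+n i j) (m≤m+n (i + j) k)) sum<m)
              j% = m<n⇒m%n≡m (≤-<-trans (≤-trans (m≤n+m j i) (m≤m+n (i + j) k)) sum<m)
              k% = m<n⇒m%n≡m (≤-<-trans (m≤n+m k (i + j)) sum<m)
              sum% = cong₂ _+_ (cong₂ _+_ i% j%) k%
          in [ (λ eq → <⇒≢ i<j (trans (sym i%) (trans eq j%))) ,
             [ (λ eq → <⇒≢ j<k (trans (sym j%) (trans eq k%))) ,
               (λ eq → <⇒≢ (<-trans i<j j<k) (trans (sym i%) (trans eq k%))) ]′ ]′
               (proj₂ check (subst (_∈ E) (sym sum%) sum∈E))
      where
      check : Harmless (i % m) (j % m) (k % m)
      check = All.lookup (All.lookup (All.lookup harmless (residue Pi)) (residue Pj)) (residue Pk)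

    -- Exceptions are not periodic; `m ≤ w` excludes them.
    pattern-shift : ∀ {w} q → m ≤ w → Pattern w → Pattern (w + q * m)
    pattern-shift q m≤w (inj₁ w∈E) = contradiction (proj₁ (All.lookup separated w∈E)) (≤⇒≯ m≤w)
    pattern-shift {w} q m≤w (inj₂ w%m∈R) = inj₂ (subst (_∈ R) (sym ([m+kn]%n≡m%n w q m)) w%m∈R)

    remainder : ∀ {p q w} → p + q + q < w → q < w ∸ (p + q) × w ≡ p + q + (w ∸ (p + q))
    remainder {p} {q} {w} lt =
      m+n≤o⇒m≤o∸n (suc q) (subst (_< w) (+-comm (p + q) q) lt) ,
      sym (m+[n∸m]≡n (≤-trans (m≤m+n (p + q) q) (<⇒≤ lt)))

    small-cover : ∀ {z} → CoveredFrom z → ∀ {w} → w < 4 * m → z < w → ¬ Pattern w →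
      ∃[ p ] ∃[ q ] Completes w p q
    small-cover covered w<4m z<w ¬Pw with find (covered w<4m z<w ¬Pw)
    ... | p , _ , completed with find completed
    ...   | q , _ , completes = p , q , completes

    pattern-cover : ∀ {z} → z < 3 * m → CoveredFrom z →
      ∀ {w} → z < w → ¬ Pattern w → DistinctSum Pattern w
    pattern-cover {z} z<3m covered {w} z<w ¬Pw with w <? 4 * m
    ... | yes w<4m =
      let p , q , p<q , p+q+q<w , _ , Pp , Pq , Pk = small-cover covered w<4m z<w ¬Pw
          q<k , w≡p+q+k = remainder {p} p+q+q<w
      in p , q , w ∸ (p + q) , p<q , q<k , Pp , Pq , Pk , w≡p+q+k
    ... | no w≮4m =
      let p , q , p<q , p+q+q<r , p+q≤2m , Pp , Pq , Pk =
            small-cover covered r<4m (<-≤-trans z<3m 3m≤r)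
              -- If `r` were in the pattern, shifting by `n * m` would put `w` there too.
              (¬Pw ∘ subst Pattern (sym w≡) ∘ pattern-shift n m≤r)
          q<k , r≡p+q+k = remainder {p} p+q+q<r
          k = r ∸ (p + q)
          m≤k = m+n≤o⇒m≤o∸n m (≤-trans (+-monoʳ-≤ m p+q≤2m) 3m≤r)
      in p , q , k + n * m , p<q , <-≤-trans q<k (m≤m+n k (n * m)) , Pp , Pq ,
         pattern-shift n m≤k Pk ,
         trans w≡ (trans (cong (_+ n * m) r≡p+q+k) (+-assoc (p + q) k (n * m)))
      where
      -- The representative of `w` mod `m` in the period from `3 * m` to `4 * m`, where the third
      -- summand is at least `m`.
      r = 3 * m + (w ∸ 3 * m) % m
      n = (w ∸ 3 * m) / m

      w≡ : w ≡ r + n * m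
      w≡ = begin
        w                                  ≡⟨ m+[n∸m]≡n (≤-trans (m≤n+m (3 * m) m) (≮⇒≥ w≮4m)) ⟨
        3 * m + (w ∸ 3 * m)                ≡⟨ cong (3 * m +_) (m≡m%n+[m/n]*n (w ∸ 3 * m) m) ⟩
        3 * m + ((w ∸ 3 * m) % m + n * m)  ≡⟨ +-assoc (3 * m) _ (n * m) ⟨
        r + n * m                          ∎
        where open ≡-Reasoning

      3m≤r : 3 * m ≤ r
      3m≤r = m≤m+n (3 * m) _

      m≤r : m ≤ r
      m≤r = ≤-trans (m≤m+n m (2 * m)) 3m≤r

      r<4m : r < 4 * m
      r<4m = subst (r <_) (+-comm (3 * m) m) (+-monoʳ-< (3 * m) (m%n<n (w ∸ 3 * m) m))

  -- A bounded family of pairs of implications, the shape decided by `allUpTo?`, `×-dec` and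
  -- `→-dec`.
  StartsWith : (x y z : ℕ) → Set
  StartsWith x y z =
    ∀ {w} → w < suc z → (Pattern w → w ∈ x ∷ y ∷ z ∷ []) × (w ∈ x ∷ y ∷ z ∷ [] → Pattern w)

  startsWith? : ∀ x y z → Dec (StartsWith x y z)
  startsWith? x y z = allUpTo? (λ w →
    (pattern? w →-dec (w ∈? (x ∷ y ∷ z ∷ []))) ×-dec
    ((w ∈? (x ∷ y ∷ z ∷ [])) →-dec pattern? w)) (suc z)

  Checks : (x y z : ℕ) → Set
  Checks x y z =
    x < y × y < z × z < 3 * m × Separated × SumsHarmless × CoveredFrom z × StartsWith x y z

  checks? : ∀ x y z → Dec (Checks x y z)
  checks? x y z = (x <? y) ×-dec ((y <? z) ×-dec ((z <? 3 * m) ×-dec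
    (separated? ×-dec (sumsHarmless? ×-dec (coveredFrom? z ×-dec startsWith? x y z)))))

  ∈S⇔pattern : ∀ {x y z} → Checks x y z → ∀ w → w ∈S[ x , y , z ] ⇔ Pattern w
  ∈S⇔pattern {x} {y} {z} (x<y , y<z , z<3m , separated , harmless , covered , starts) =
    entry⇔ (S-isGreedy x y z) x<y y<z pattern?
      (λ w≤z → mk⇔ (proj₁ (starts (s≤s w≤z))) (proj₂ (starts (s≤s w≤z))))
      (pattern-sumFree separated harmless)
      (pattern-cover separated z<3m covered)

-- The three sequences as instances.

theorem4 : (z : ℕ) → .{{_ : NonZero z}} →
    (z ∈S[ 1 , 2 , 3 ] ⇔ (z ∈ 1 ∷ 5 ∷ 13 ∷ [] ⊎ z % 23 ∈ 2 ∷ 3 ∷ 4 ∷ 14 ∷ 15 ∷ [])) ×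
    (z ∈S[ 1 , 3 , 4 ] ⇔ (z ∈ 1 ∷ 7 ∷ 19 ∷ [] ⊎ z % 33 ∈ 3 ∷ 4 ∷ 5 ∷ 6 ∷ 20 ∷ 21 ∷ 22 ∷ [])) ×
    (z ∈S[ 1 , 4 , 5 ] ⇔ (z ∈ 1 ∷ 9 ∷ 25 ∷ [] ⊎ z % 43 ∈ 4 ∷ 5 ∷ 6 ∷ 7 ∷ 8 ∷ 26 ∷ 27 ∷ 28 ∷ 29 ∷ []))
theorem4 z =
  -- `from-yes` has the type checker evaluate all finite checks; `Pattern` unfolds to the right-hand
  -- side of the claim.
  S₂.∈S⇔pattern (from-yes (S₂.checks? 1 2 3)) z ,
  S₃.∈S⇔pattern (from-yes (S₃.checks? 1 3 4)) z ,
  S₄.∈S⇔pattern (from-yes (S₄.checks? 1 4 5)) z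
  where
  module S₂ = Periodic (1 ∷ 5 ∷ 13 ∷ []) (2 ∷ 3 ∷ 4 ∷ 14 ∷ 15 ∷ []) 23
  module S₃ = Periodic (1 ∷ 7 ∷ 19 ∷ []) (3 ∷ 4 ∷ 5 ∷ 6 ∷ 20 ∷ 21 ∷ 22 ∷ []) 33
  module S₄ = Periodic (1 ∷ 9 ∷ 25 ∷ []) (4 ∷ 5 ∷ 6 ∷ 7 ∷ 8 ∷ 26 ∷ 27 ∷ 28 ∷ 29 ∷ []) 43
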